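{- Let $m$ be even and let $\mathbb{A}\in T_{m,n}$ be a $Z$ tensor. If $\mathbb{A}$ is a $B$ tensor, then $\mathbb{A}$ is a $P$ tensor. If $\mathbb{A}$ is a $B_0$ tensor, then $\mathbb{A}$ is a $P_0$ tensor.
   Context: $T_{m,n}$ denotes the set of real $m$th order $n$-dimensional tensors $\mathbb{A}=(a_{i_1i_2\ldots i_m})$ with $i_j\in[n]=\{1,\ldots,n\}$. $\mathbb{A}$ is a $Z$ tensor if $a_{i_1\ldots i_m}\le0$ whenever $(i_1,\ldots,i_m)$ is not of the form $(i,\ldots,i)$. For $x\in\mathbb{R}^n$, $(\mathbb{A}x^{m-1})_i=\sum_{i_2,\ldots,i_m=1}^n a_{ii_2\ldots i_m}x_{i_2}\cdots x_{i_m}$. $\mathbb{A}$ is a $P$ tensor if for every nonzero $x\in\mathbb{R}^n$, $\max_{i\in[n]}x_i(\mathbb{A}x^{m-1})_i>0$; it is a $P_0$ tensor if for every nonzero $x\in\mathbb{R}^n$ there is $i\in[n]$ with $x_i\ne0$ and $x_i(\mathbb{A}x^{m-1})_i\ge0$. $\mathbb{A}$ is a $B$ tensor if for all $i\in[n]$, $\sum_{i_2,\ldots,i_m=1}^n a_{ii_2\ldots i_m}>0$ and $\frac{1}{n^{m-1}}\sum_{i_2,\ldots,i_m=1}^n a_{ii_2\ldots i_m}>a_{ij_2\ldots j_m}$ for all $(j_2,\ldots,j_m)\neq(i,\ldots,i)$. $\mathbb{A}$ is a $B_0$ tensor if the same two conditions hold with $\ge$ in place of $>$. -}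

module Defs where

open import Algebra.Bundles using (CommutativeRing)
open import Algebra.Core using (Op₁; Op₂)
open import Algebra.Structures using (IsCommutativeRing)
import Algebra.Construct.NaturalChoice.Max as Max
import Algebra.Properties.CommutativeMonoid.Sum as Sum
import Algebra.Properties.Semiring.Mult as Mult
open import Data.Fin.Base using (Fin)
open import Data.Nat.Base as ℕ using (ℕ; zero; suc; NonZero)
open import Data.Product.Base using (∃; ∃-syntax; _×_)
open import Data.Vec.Base using (Vec; []; _∷_; foldr′; map; replicate)
open import Data.Vec.Functional as Vector using (Vector)
open import Level as Level using (Level; _⊔_)
open import Relation.Binary.Bundles using (DecTotalOrder)
open import Relation.Binary.Core using (Rel)
import Relation.Binary.Construct.NonStrictToStrict as ToStrict
open import Relation.Binary.PropositionalEquality.Core using (_≡_; _≢_)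
open import Relation.Binary.Structures using (IsDecTotalOrder)
open import Relation.Nullary.Negation.Core using (¬_)
open import Relation.Unary using (Pred)

-- The real numbers are given by their axiomatic characterisation as a complete
-- linearly ordered field.  The order is decidable, so arguments by cases on the
-- sign of a real number are available, as in classical mathematics.

record Reals (c ℓ₁ ℓ₂ : Level) : Set (Level.suc (c ⊔ ℓ₁ ⊔ ℓ₂)) where
  infix  8 _⁻¹
  infix  8 -_
  infixl 7 _*_
  infixl 6 _+_
  infix  4 _≈_ _≤_

  field
    Carrier : Set c
    _≈_     : Rel Carrier ℓ₁
    _≤_     : Rel Carrier ℓ₂
    _+_ _*_ : Op₂ Carrier
    -_      : Op₁ Carrier
    0# 1#   : Carrier
    -- Total; nothing is assumed about its value at 0#.
    _⁻¹     : Op₁ Carrier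

    isCommutativeRing : IsCommutativeRing _≈_ _+_ _*_ -_ 0# 1#
    isDecTotalOrder   : IsDecTotalOrder _≈_ _≤_

    0≉1        : ¬ (0# ≈ 1#)
    *-inverseʳ : ∀ {x} → ¬ (x ≈ 0#) → x * x ⁻¹ ≈ 1#
    +-monoˡ-≤  : ∀ {x y} z → x ≤ y → x + z ≤ y + z
    *-nonNeg   : ∀ {x y} → 0# ≤ x → 0# ≤ y → 0# ≤ x * y

  UpperBound : ∀ {ℓ} → Pred Carrier ℓ → Carrier → Set (c ⊔ ℓ₂ ⊔ ℓ)
  UpperBound S b = ∀ x → S x → x ≤ b

  field
    complete : (S : Pred Carrier (c ⊔ ℓ₁ ⊔ ℓ₂)) → ∃ S → ∃ (UpperBound S) →
               ∃[ s ] UpperBound S s × (∀ b → UpperBound S b → s ≤ b)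

  commutativeRing : CommutativeRing c ℓ₁
  commutativeRing = record { isCommutativeRing = isCommutativeRing }

  decTotalOrder : DecTotalOrder c ℓ₁ ℓ₂
  decTotalOrder = record { isDecTotalOrder = isDecTotalOrder }

  open CommutativeRing commutativeRing public
    using (_≉_; semiring; +-commutativeMonoid)
  open DecTotalOrder decTotalOrder public
    using (totalOrder)
  open ToStrict _≈_ _≤_ public
    using (_<_)

module Tensors {c ℓ₁ ℓ₂} (ℝ : Reals c ℓ₁ ℓ₂) where
  open Reals ℝ
  open Max totalOrder using () renaming (_⊔_ to _⊔ᵣ_)
  open Sum +-commutativeMonoid using (sum)
  open Mult semiring using () renaming (_×_ to _×ᵣ_)

  -- Multi-indices are vectors, so that their equality is decidable.
  Tensor : ℕ → ℕ → Set c
  Tensor m n = Vec (Fin n) m → Carrier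

  private variable
    k m n : ℕ

  -- Sum over all (i₁ , … , iₖ) ∈ [n]ᵏ.
  multiSum : ∀ k → (Vec (Fin n) k → Carrier) → Carrier
  multiSum zero    f = f []
  multiSum (suc k) f = sum λ i → multiSum k λ is → f (i ∷ is)

  -- Below, a tensor whose first index plays a special role has order
  -- m = suc k, so that k = m - 1.

  infix 8 _·_^m-1
  _·_^m-1 : Tensor (suc k) n → Vector Carrier n → Vector Carrier n
  (A · x ^m-1) i =
    multiSum _ λ is → A (i ∷ is) * foldr′ _*_ 1# (map x is)

  rowSum : Tensor (suc k) n → Fin n → Carrier
  rowSum A i = multiSum _ λ is → A (i ∷ is)

  -- (1 / nᵏ) · rowSum A i
  rowMean : Tensor (suc k) n → Fin n → Carrier
  rowMean {k} {n} A i = ((n ℕ.^ k) ×ᵣ 1#) ⁻¹ * rowSum A i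

  maximum : .{{_ : NonZero n}} → Vector Carrier n → Carrier
  maximum {n = suc _} v = Vector.foldr _⊔ᵣ_ (Vector.head v) (Vector.tail v)

  NonZeroVector : Vector Carrier n → Set ℓ₁
  NonZeroVector x = ¬ (∀ i → x i ≈ 0#)

  IsZ : Tensor m n → Set ℓ₂
  IsZ {m} A = ∀ is → ¬ (∃[ i ] is ≡ replicate m i) → A is ≤ 0#

  IsP : .{{_ : NonZero n}} → Tensor (suc k) n → Set (c ⊔ ℓ₁ ⊔ ℓ₂)
  IsP A = ∀ x → NonZeroVector x → 0# < maximum (λ i → x i * (A · x ^m-1) i)

  IsP₀ : Tensor (suc k) n → Set (c ⊔ ℓ₁ ⊔ ℓ₂)
  IsP₀ A = ∀ x → NonZeroVector x →
           ∃[ i ] x i ≉ 0# × 0# ≤ x i * (A · x ^m-1) i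

  IsB : Tensor (suc k) n → Set (ℓ₁ ⊔ ℓ₂)
  IsB {k} A = ∀ i → 0# < rowSum A i ×
                    (∀ js → js ≢ replicate k i → A (i ∷ js) < rowMean A i)

  IsB₀ : Tensor (suc k) n → Set ℓ₂
  IsB₀ {k} A = ∀ i → 0# ≤ rowSum A i ×
                     (∀ js → js ≢ replicate k i → A (i ∷ js) ≤ rowMean A i)

{-# OPTIONS --safe #-}
-- Let x ≠ 0 and let xᵢ be an entry of largest absolute value μ > 0.  Since m is
-- even, xᵢᵐ = μᵐ, and every product of m entries of x is at most μᵐ.  As the
-- off-diagonal entries of A are nonpositive, each term of xᵢ (A xᵐ⁻¹)ᵢ is
-- at least μᵐ times the entry of A, so xᵢ (A xᵐ⁻¹)ᵢ ≥ μᵐ · (i-th row sum).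
module Submission where

open import Defs
import Algebra.Construct.NaturalChoice.Max as Max
open import Algebra.Bundles using (CommutativeRing)
import Algebra.Properties.Ring as RingProperties
import Algebra.Properties.Semiring.Exp as Exp
import Algebra.Properties.Semiring.Sum as Sum
open import Data.Fin.Base using (Fin; zero; suc)
import Data.Fin.Properties as Fin
import Data.List.Base as List
import Data.List.Extrema as Extrema
open import Data.List.Membership.Propositional.Properties using (∈-allFin)
import Data.List.Relation.Unary.All as All
open import Data.Nat.Base as ℕ using (ℕ; zero; suc; NonZero)
open import Data.Nat.Divisibility using (_∣_; divides)
import Data.Nat.Properties as ℕ
open import Data.Product.Base using (_×_; _,_; proj₁; ∃-syntax)
open import Data.Sum.Base using (inj₁; inj₂)
open import Data.Vec.Base using (Vec; []; _∷_; foldr′; map; replicate)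
open import Data.Vec.Functional using (Vector; head; tail; foldr)
open import Data.Vec.Properties using (≡-dec; ∷-injective)
open import Relation.Binary.Bundles using (DecTotalOrder)
open import Relation.Binary.PropositionalEquality as ≡ using (_≡_; _≢_)
import Relation.Binary.Reasoning.PartialOrder as ≤-Reasoning
open import Relation.Nullary using (¬_; yes; no)

module OrderedField {c ℓ₁ ℓ₂} (ℝ : Reals c ℓ₁ ℓ₂) where
  open Reals ℝ public
  open CommutativeRing commutativeRing public
    using ( ring; +-congˡ; +-comm; +-assoc; +-identityˡ; -‿cong; -‿inverseʳ; -‿inverseˡ
          ; *-congˡ; *-congʳ; *-comm; *-assoc; *-identityˡ; *-identityʳ; zeroʳ)
  open DecTotalOrder decTotalOrder public
    using (poset; total; antisym; ≤-respˡ-≈; ≤-respʳ-≈; module Eq)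
    renaming (refl to ≤-refl; trans to ≤-trans; reflexive to ≤-reflexive)
  open Exp semiring public using (_^_; ^-congˡ; ^-congʳ; ^-assocʳ)
  open Sum semiring public using (sum; *-distribˡ-sum; sum-cong-≋)
  open Max totalOrder public using (_⊔_; x≤x⊔y; x≤y⊔x; ⊔-lub; ⊔-sel; ⊔-comm; ⊔-cong)
  open RingProperties ring public
    using (-‿distribˡ-*; -‿distribʳ-*; -‿involutive; -0#≈0#; x[y-z]≈xy-xz)
  open ≤-Reasoning poset

  -- Arithmetic in an ordered field.

  +-monoʳ-≤ : ∀ {x y} z → x ≤ y → z + x ≤ z + y
  +-monoʳ-≤ {x} {y} z x≤y = begin
    z + x ≈⟨ +-comm z x ⟩
    x + z ≤⟨ +-monoˡ-≤ z x≤y ⟩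
    y + z ≈⟨ +-comm y z ⟩
    z + y ∎

  +-mono-≤ : ∀ {x y u v} → x ≤ y → u ≤ v → x + u ≤ y + v
  +-mono-≤ x≤y u≤v = ≤-trans (+-monoˡ-≤ _ x≤y) (+-monoʳ-≤ _ u≤v)

  x≤y⇒0≤y-x : ∀ {x y} → x ≤ y → 0# ≤ y + - x
  x≤y⇒0≤y-x {x} x≤y = ≤-respˡ-≈ (-‿inverseʳ x) (+-monoˡ-≤ (- x) x≤y)

  0≤y-x⇒x≤y : ∀ {x y} → 0# ≤ y + - x → x ≤ y
  0≤y-x⇒x≤y {x} {y} 0≤y-x = begin
    x               ≈⟨ +-identityˡ x ⟨
    0# + x          ≤⟨ +-monoˡ-≤ x 0≤y-x ⟩
    y + - x + x     ≈⟨ +-assoc y (- x) x ⟩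
    y + (- x + x)   ≈⟨ +-congˡ (-‿inverseˡ x) ⟩
    y + 0#          ≈⟨ +-comm y 0# ⟩
    0# + y          ≈⟨ +-identityˡ y ⟩
    y               ∎

  neg-mono-≤ : ∀ {x y} → x ≤ y → - y ≤ - x
  neg-mono-≤ {x} {y} x≤y = 0≤y-x⇒x≤y (begin
    0#             ≤⟨ x≤y⇒0≤y-x x≤y ⟩
    y + - x        ≈⟨ +-comm y (- x) ⟩
    - x + y        ≈⟨ +-congˡ (-‿involutive y) ⟨
    - x + - (- y)  ∎)

  neg-nonPos : ∀ {x} → x ≤ 0# → 0# ≤ - x
  neg-nonPos x≤0 = ≤-respˡ-≈ -0#≈0# (neg-mono-≤ x≤0)

  *-monoʳ-≤-nonNeg : ∀ {x y z} → 0# ≤ z → x ≤ y → z * x ≤ z * y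
  *-monoʳ-≤-nonNeg {x} {y} {z} 0≤z x≤y = 0≤y-x⇒x≤y
    (≤-respʳ-≈ (x[y-z]≈xy-xz z y x) (*-nonNeg 0≤z (x≤y⇒0≤y-x x≤y)))

  *-monoˡ-≤-nonNeg : ∀ {x y z} → 0# ≤ z → x ≤ y → x * z ≤ y * z
  *-monoˡ-≤-nonNeg {x} {y} {z} 0≤z x≤y = begin
    x * z ≈⟨ *-comm x z ⟩
    z * x ≤⟨ *-monoʳ-≤-nonNeg 0≤z x≤y ⟩
    z * y ≈⟨ *-comm z y ⟩
    y * z ∎

  -- Multiplying by the nonnegative `- z` preserves the order, and taking negatives then reverses
  -- it. The off-diagonal entries of a Z tensor play the role of `z`.
  *-monoʳ-≤-nonPos : ∀ {x y z} → z ≤ 0# → x ≤ y → z * y ≤ z * x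
  *-monoʳ-≤-nonPos {x} {y} {z} z≤0 x≤y = begin
    z * y        ≈⟨ -‿involutive (z * y) ⟨
    - - (z * y)  ≈⟨ -‿cong (-‿distribˡ-* z y) ⟩
    - (- z * y)  ≤⟨ neg-mono-≤ (*-monoʳ-≤-nonNeg (neg-nonPos z≤0) x≤y) ⟩
    - (- z * x)  ≈⟨ -‿cong (-‿distribˡ-* z x) ⟨
    - - (z * x)  ≈⟨ -‿involutive (z * x) ⟩
    z * x        ∎

  neg-*-neg : ∀ x y → - x * - y ≈ x * y
  neg-*-neg x y = begin-equality
    - x * - y    ≈⟨ -‿distribˡ-* x (- y) ⟨
    - (x * - y)  ≈⟨ -‿cong (-‿distribʳ-* x y) ⟨
    - - (x * y)  ≈⟨ -‿involutive (x * y) ⟩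
    x * y        ∎

  -- The inverse of `x` cancels it from `x * y ≈ 0#`. As `<` means `≤` together with `≉`, this is
  -- the strict half of `*-pos`.
  *-nonZero : ∀ {x y} → x ≉ 0# → y ≉ 0# → x * y ≉ 0#
  *-nonZero {x} {y} x≉0 y≉0 xy≈0 = y≉0 (begin-equality
    y               ≈⟨ *-identityˡ y ⟨
    1# * y          ≈⟨ *-congʳ (*-inverseʳ x≉0) ⟨
    x * x ⁻¹ * y    ≈⟨ *-congʳ (*-comm x (x ⁻¹)) ⟩
    x ⁻¹ * x * y    ≈⟨ *-assoc (x ⁻¹) x y ⟩
    x ⁻¹ * (x * y)  ≈⟨ *-congˡ xy≈0 ⟩
    x ⁻¹ * 0#       ≈⟨ zeroʳ (x ⁻¹) ⟩
    0#              ∎)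

  *-pos : ∀ {x y} → 0# < x → 0# < y → 0# < x * y
  *-pos (0≤x , 0≉x) (0≤y , 0≉y) =
    *-nonNeg 0≤x 0≤y ,
    λ 0≈xy → *-nonZero (λ e → 0≉x (Eq.sym e)) (λ e → 0≉y (Eq.sym e)) (Eq.sym 0≈xy)

  0≤1 : 0# ≤ 1#
  0≤1 with total 0# 1#
  ... | inj₁ p = p
  -- If `1# ≤ 0#`, then `- 1#` is nonnegative, and hence so is its square, which is `1#`.
  ... | inj₂ p = ≤-respʳ-≈ (Eq.trans (neg-*-neg 1# 1#) (*-identityˡ 1#))
                   (*-nonNeg (neg-nonPos p) (neg-nonPos p))

  ^-pos : ∀ {x} → 0# < x → ∀ n → 0# < x ^ n
  ^-pos 0<x zero    = 0≤1 , 0≉1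
  ^-pos 0<x (suc n) = *-pos 0<x (^-pos 0<x n)

  -- Absolute value and even powers.

  ∣_∣ : Carrier → Carrier
  ∣ x ∣ = x ⊔ - x

  x≤∣x∣ : ∀ x → x ≤ ∣ x ∣
  x≤∣x∣ x = x≤x⊔y x (- x)

  -x≤∣x∣ : ∀ x → - x ≤ ∣ x ∣
  -x≤∣x∣ x = x≤y⊔x x (- x)

  0≤∣x∣ : ∀ x → 0# ≤ ∣ x ∣
  0≤∣x∣ x with total 0# x
  ... | inj₁ 0≤x = ≤-trans 0≤x (x≤∣x∣ x)
  ... | inj₂ x≤0 = ≤-trans (neg-nonPos x≤0) (-x≤∣x∣ x)

  ∣-x∣≈∣x∣ : ∀ x → ∣ - x ∣ ≈ ∣ x ∣
  ∣-x∣≈∣x∣ x = Eq.trans (⊔-cong Eq.refl (-‿involutive x)) (⊔-comm (- x) x)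

  ∣x∣≤0⇒x≈0 : ∀ {x} → ∣ x ∣ ≤ 0# → x ≈ 0#
  ∣x∣≤0⇒x≈0 {x} ∣x∣≤0 = antisym (≤-trans (x≤∣x∣ x) ∣x∣≤0)
    (≤-respʳ-≈ (-‿involutive x) (neg-nonPos (≤-trans (-x≤∣x∣ x) ∣x∣≤0)))

  0<∣x∣⇒x≉0 : ∀ {x} → 0# < ∣ x ∣ → x ≉ 0#
  0<∣x∣⇒x≉0 (0≤∣x∣ , 0≉∣x∣) x≈0 = 0≉∣x∣ (antisym 0≤∣x∣ (⊔-lub (≤-reflexive x≈0)
    (≤-reflexive (Eq.trans (-‿cong x≈0) -0#≈0#))))

  -- A case split on the sign of `y` suffices: if `y ≤ 0#`, the product is rewritten as `- x * - y`,
  -- so the second factor is nonnegative in both cases and the factors can be enlarged one after the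
  -- other.
  xy≤∣x∣∣y∣ : ∀ x y → x * y ≤ ∣ x ∣ * ∣ y ∣
  xy≤∣x∣∣y∣ x y with total 0# y
  ... | inj₁ 0≤y = begin
    x * y          ≤⟨ *-monoˡ-≤-nonNeg 0≤y (x≤∣x∣ x) ⟩
    ∣ x ∣ * y      ≤⟨ *-monoʳ-≤-nonNeg (0≤∣x∣ x) (x≤∣x∣ y) ⟩
    ∣ x ∣ * ∣ y ∣  ∎
  ... | inj₂ y≤0 = begin
    x * y          ≈⟨ neg-*-neg x y ⟨
    - x * - y      ≤⟨ *-monoˡ-≤-nonNeg (neg-nonPos y≤0) (-x≤∣x∣ x) ⟩
    ∣ x ∣ * - y    ≤⟨ *-monoʳ-≤-nonNeg (0≤∣x∣ x) (-x≤∣x∣ y) ⟩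
    ∣ x ∣ * ∣ y ∣  ∎

  ∣xy∣≤∣x∣∣y∣ : ∀ x y → ∣ x * y ∣ ≤ ∣ x ∣ * ∣ y ∣
  ∣xy∣≤∣x∣∣y∣ x y = ⊔-lub (xy≤∣x∣∣y∣ x y) (begin
    - (x * y)        ≈⟨ -‿distribˡ-* x y ⟩
    - x * y          ≤⟨ xy≤∣x∣∣y∣ (- x) y ⟩
    ∣ - x ∣ * ∣ y ∣  ≈⟨ *-congʳ (∣-x∣≈∣x∣ x) ⟩
    ∣ x ∣ * ∣ y ∣    ∎)

  ∣1∣≤1 : ∣ 1# ∣ ≤ 1#
  ∣1∣≤1 = ⊔-lub ≤-refl (begin
    - 1#  ≤⟨ neg-mono-≤ 0≤1 ⟩
    - 0#  ≈⟨ -0#≈0# ⟩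
    0#    ≤⟨ 0≤1 ⟩
    1#    ∎)

  ∣x∣^2≈x^2 : ∀ x → ∣ x ∣ ^ 2 ≈ x ^ 2
  ∣x∣^2≈x^2 x with ⊔-sel x (- x)
  ... | inj₁ ∣x∣≈x  = ^-congˡ 2 ∣x∣≈x
  ... | inj₂ ∣x∣≈-x = begin-equality
    ∣ x ∣ ^ 2          ≈⟨ ^-congˡ 2 ∣x∣≈-x ⟩
    - x * (- x * 1#)   ≈⟨ *-congˡ (*-identityʳ (- x)) ⟩
    - x * - x          ≈⟨ neg-*-neg x x ⟩
    x * x              ≈⟨ *-congˡ (*-identityʳ x) ⟨
    x ^ 2              ∎

  -- Evenness enters here: with m = 2q both sides are q-th powers of squares, and squaring removes
  -- the sign.
  ∣x∣^m≈x^m : ∀ {m} x → 2 ∣ m → ∣ x ∣ ^ m ≈ x ^ m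
  ∣x∣^m≈x^m x (divides q ≡.refl) = begin-equality
    ∣ x ∣ ^ (q ℕ.* 2)  ≈⟨ ^-congʳ ∣ x ∣ (ℕ.*-comm q 2) ⟩
    ∣ x ∣ ^ (2 ℕ.* q)  ≈⟨ ^-assocʳ ∣ x ∣ 2 q ⟨
    (∣ x ∣ ^ 2) ^ q    ≈⟨ ^-congˡ q (∣x∣^2≈x^2 x) ⟩
    (x ^ 2) ^ q        ≈⟨ ^-assocʳ x 2 q ⟩
    x ^ (2 ℕ.* q)      ≈⟨ ^-congʳ x (ℕ.*-comm q 2) ⟨
    x ^ (q ℕ.* 2)      ∎

  sum-mono-≤ : ∀ {n} {f g : Vector Carrier n} → (∀ i → f i ≤ g i) → sum f ≤ sum g
  sum-mono-≤ {zero}  f≤g = ≤-refl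
  sum-mono-≤ {suc n} f≤g = +-mono-≤ (f≤g zero) (sum-mono-≤ (λ i → f≤g (suc i)))

module TensorProperties {c ℓ₁ ℓ₂} (ℝ : Reals c ℓ₁ ℓ₂) where
  open OrderedField ℝ
  open Tensors ℝ
  open ≤-Reasoning poset

  -- Sums over multi-indices, and maxima.

  multiSum-mono-≤ : ∀ {n} k {f g : Vec (Fin n) k → Carrier} →
                    (∀ is → f is ≤ g is) → multiSum k f ≤ multiSum k g
  multiSum-mono-≤ zero    f≤g = f≤g []
  multiSum-mono-≤ (suc k) f≤g =
    sum-mono-≤ λ i → multiSum-mono-≤ k λ is → f≤g (i ∷ is)

  *-distribˡ-multiSum : ∀ {n} k a (f : Vec (Fin n) k → Carrier) →
                        a * multiSum k f ≈ multiSum k (λ is → a * f is)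
  *-distribˡ-multiSum zero    a f = Eq.refl
  *-distribˡ-multiSum (suc k) a f = Eq.trans (*-distribˡ-sum a λ i → multiSum k λ is → f (i ∷ is))
    (sum-cong-≋ λ i → *-distribˡ-multiSum k a λ is → f (i ∷ is))

  -- `maximum` folds the tail starting from the head, so the head is bounded as the initial value of
  -- the fold, and the other entries by `vᵢ≤foldr-⊔`.
  x≤foldr-⊔ : ∀ {n} a (v : Vector Carrier n) → a ≤ foldr _⊔_ a v
  x≤foldr-⊔ {zero}  a v = ≤-refl
  x≤foldr-⊔ {suc n} a v = ≤-trans (x≤foldr-⊔ a (tail v)) (x≤y⊔x (head v) _)

  vᵢ≤foldr-⊔ : ∀ {n} a (v : Vector Carrier n) i → v i ≤ foldr _⊔_ a v
  vᵢ≤foldr-⊔ a v zero    = x≤x⊔y (head v) _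
  vᵢ≤foldr-⊔ a v (suc i) = ≤-trans (vᵢ≤foldr-⊔ a (tail v) i) (x≤y⊔x (head v) _)

  maximum-upper : ∀ {n} .{{_ : NonZero n}} (v : Vector Carrier n) i → v i ≤ maximum v
  maximum-upper {suc n} v zero    = x≤foldr-⊔ (head v) (tail v)
  maximum-upper {suc n} v (suc i) = vᵢ≤foldr-⊔ (head v) (tail v) i

  maxAbs : ∀ {n} .{{_ : NonZero n}} (x : Vector Carrier n) → ∃[ i ] ∀ j → ∣ x j ∣ ≤ ∣ x i ∣
  maxAbs {suc n} x =
    -- The index `zero` is the default of `argmax`; it exists because `n` is positive.
    argmax (λ i → ∣ x i ∣) zero (List.allFin _) ,
    λ j → All.lookup (f[xs]≤f[argmax] zero (List.allFin _)) (∈-allFin j)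
    where open Extrema totalOrder

  -- If the largest absolute value were zero, every entry of `x` would vanish.
  maxAbs-pos : ∀ {n} {x : Vector Carrier n} {i} → NonZeroVector x →
               (∀ j → ∣ x j ∣ ≤ ∣ x i ∣) → 0# < ∣ x i ∣
  maxAbs-pos {x = x} {i} x≢0 x≤xᵢ = 0≤∣x∣ (x i) , λ 0≈∣xᵢ∣ →
    x≢0 λ j → ∣x∣≤0⇒x≈0 (≤-respʳ-≈ (Eq.sym 0≈∣xᵢ∣) (x≤xᵢ j))

  -- Products of entries of a vector.

  prod : ∀ {k} → Vec Carrier k → Carrier
  prod = foldr′ _*_ 1#

  -- The induction runs on absolute values because upper bounds on factors of unknown sign do not
  -- multiply.
  ∣prod∣≤ : ∀ {n} {x : Vector Carrier n} {μ} → 0# ≤ μ → (∀ j → ∣ x j ∣ ≤ μ) →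
            ∀ {k} (js : Vec (Fin n) k) → ∣ prod (map x js) ∣ ≤ μ ^ k
  ∣prod∣≤ 0≤μ ∣x∣≤μ [] = ∣1∣≤1
  ∣prod∣≤ {x = x} {μ} 0≤μ ∣x∣≤μ {suc k} (j ∷ js) = begin
    ∣ x j * prod (map x js) ∣      ≤⟨ ∣xy∣≤∣x∣∣y∣ _ _ ⟩
    ∣ x j ∣ * ∣ prod (map x js) ∣  ≤⟨ *-monoˡ-≤-nonNeg (0≤∣x∣ _) (∣x∣≤μ j) ⟩
    μ * ∣ prod (map x js) ∣        ≤⟨ *-monoʳ-≤-nonNeg 0≤μ (∣prod∣≤ 0≤μ ∣x∣≤μ js) ⟩
    μ * μ ^ k                      ∎

  prod-replicate : ∀ {n} (x : Vector Carrier n) i k → prod (map x (replicate k i)) ≡ x i ^ k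
  prod-replicate x i zero    = ≡.refl
  prod-replicate x i (suc k) = ≡.cong (x i *_) (prod-replicate x i k)

  off-diagonal : ∀ {n k} {i : Fin n} {js : Vec (Fin n) k} → js ≢ replicate k i →
                 ¬ (∃[ j ] i ∷ js ≡ replicate (suc k) j)
  off-diagonal js≢ (j , eq) with ∷-injective eq
  ... | ≡.refl , js≡ = js≢ js≡

  -- The row of the entry of largest absolute value.

  module _ {k n} (2∣m : 2 ∣ suc k) {A : Tensor (suc k) n} (isZ : IsZ A)
           {x : Vector Carrier n} {i : Fin n} (x≤xᵢ : ∀ j → ∣ x j ∣ ≤ ∣ x i ∣) where

    private
      μᵐ : Carrier
      μᵐ = ∣ x i ∣ ^ suc k

    term-≥ : ∀ js → μᵐ * A (i ∷ js) ≤ x i * (A (i ∷ js) * prod (map x js))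
    term-≥ js = begin
      μᵐ * A (i ∷ js)                         ≈⟨ *-comm μᵐ _ ⟩
      A (i ∷ js) * μᵐ                         ≤⟨ bound ⟩
      -- Absorbing `x i` makes this a product of all m entries indexed by `i ∷ js`, comparable with
      -- `μᵐ`.
      A (i ∷ js) * (x i * prod (map x js))    ≈⟨ *-assoc _ _ _ ⟨
      A (i ∷ js) * x i * prod (map x js)      ≈⟨ *-congʳ (*-comm _ _) ⟩
      x i * A (i ∷ js) * prod (map x js)      ≈⟨ *-assoc _ _ _ ⟩
      x i * (A (i ∷ js) * prod (map x js))    ∎
      where
      bound : A (i ∷ js) * μᵐ ≤ A (i ∷ js) * prod (map x (i ∷ js))
      bound with ≡-dec Fin._≟_ js (replicate k i)
      -- The diagonal entry may have either sign, so an inequality between the powers would not do;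
      -- evenness gives the equality of `μᵐ` with the m-th power of `x i`.
      ... | yes ≡.refl = ≤-reflexive (*-congˡ (Eq.trans (∣x∣^m≈x^m (x i) 2∣m)
                           (Eq.reflexive (≡.sym (prod-replicate x i (suc k))))))
      -- The product is at most `μᵐ`, and the nonpositive entry reverses this.
      ... | no js≢ = *-monoʳ-≤-nonPos (isZ (i ∷ js) (off-diagonal js≢))
                       (≤-trans (x≤∣x∣ _) (∣prod∣≤ (0≤∣x∣ (x i)) x≤xᵢ (i ∷ js)))

    rowSum-bound : μᵐ * rowSum A i ≤ x i * (A · x ^m-1) i
    rowSum-bound = begin
      μᵐ * rowSum A i                        ≈⟨ *-distribˡ-multiSum k μᵐ _ ⟩
      multiSum k (λ js → μᵐ * A (i ∷ js))    ≤⟨ multiSum-mono-≤ k term-≥ ⟩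
      multiSum k (λ js → x i * (A (i ∷ js) * prod (map x js)))
                                             ≈⟨ *-distribˡ-multiSum k (x i) _ ⟨
      x i * (A · x ^m-1) i                   ∎

    rowSum-pos⇒pos : 0# < ∣ x i ∣ → 0# < rowSum A i → 0# < x i * (A · x ^m-1) i
    rowSum-pos⇒pos 0<∣xᵢ∣ 0<r = begin-strict
      0#                    <⟨ *-pos (^-pos 0<∣xᵢ∣ (suc k)) 0<r ⟩
      μᵐ * rowSum A i       ≤⟨ rowSum-bound ⟩
      x i * (A · x ^m-1) i  ∎

    rowSum-nonNeg⇒nonNeg : 0# < ∣ x i ∣ → 0# ≤ rowSum A i → 0# ≤ x i * (A · x ^m-1) i
    rowSum-nonNeg⇒nonNeg 0<∣xᵢ∣ 0≤r =
      ≤-trans (*-nonNeg (proj₁ (^-pos 0<∣xᵢ∣ (suc k))) 0≤r) rowSum-bound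

  -- From row sums to P and P₀ tensors.

  Z∧B⇒P : ∀ {k n} .{{_ : NonZero n}} → 2 ∣ suc k →
          {A : Tensor (suc k) n} → IsZ A → IsB A → IsP A
  Z∧B⇒P 2∣m {A} isZ isB x x≢0 with maxAbs x
  ... | i , x≤xᵢ = begin-strict
    0#                                    <⟨ rowSum-pos⇒pos 2∣m isZ x≤xᵢ
                                               (maxAbs-pos x≢0 x≤xᵢ) (proj₁ (isB i)) ⟩
    x i * (A · x ^m-1) i                  ≤⟨ maximum-upper (λ j → x j * (A · x ^m-1) j) i ⟩
    maximum (λ j → x j * (A · x ^m-1) j)  ∎

  -- The index of largest absolute value is the witness: its entry is nonzero because its absolute
  -- value is positive.
  Z∧B₀⇒P₀ : ∀ {k n} .{{_ : NonZero n}} → 2 ∣ suc k →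
            {A : Tensor (suc k) n} → IsZ A → IsB₀ A → IsP₀ A
  Z∧B₀⇒P₀ 2∣m isZ isB₀ x x≢0 with maxAbs x
  ... | i , x≤xᵢ = i , 0<∣x∣⇒x≉0 0<∣xᵢ∣ ,
                   rowSum-nonNeg⇒nonNeg 2∣m isZ x≤xᵢ 0<∣xᵢ∣ (proj₁ (isB₀ i))
    where 0<∣xᵢ∣ = maxAbs-pos x≢0 x≤xᵢ

theorem3p6 : ∀ {c ℓ₁ ℓ₂} (ℝ : Reals c ℓ₁ ℓ₂) → let open Tensors ℝ in
    ∀ (k n : ℕ) .{{_ : NonZero n}} → 2 ∣ suc k →
    (A : Tensor (suc k) n) → IsZ A →
    (IsB A → IsP A) × (IsB₀ A → IsP₀ A)
theorem3p6 ℝ k n 2∣m A isZ = Z∧B⇒P 2∣m isZ , Z∧B₀⇒P₀ 2∣m isZ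
  where open TensorProperties ℝ
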